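{- For every integer $k\geq 3$ there exist a constant $c_k>0$ (depending only on $k$) and a sequence $(f_n)_{n\geq 1}$, where each $f_n:\{0,1\}^{n^k}\rightarrow\{0,1\}$ is a non-constant $k$-partite $k$-uniform hypergraph property, such that $s(f_n)\leq c_k\, n^{\lceil k/3\rceil}$ for all $n\geq 1$; that is, $s(f_n)=O(n^{\lceil k/3\rceil})$.
   Context: For a Boolean function $f:\{0,1\}^N\rightarrow\{0,1\}$ and an input $x\in\{0,1\}^N$, let $x^{\{i\}}$ denote $x$ with its $i$-th bit flipped. The sensitivity of $f$ on $x$ is $s(f,x)=|\{i : f(x)\neq f(x^{\{i\}})\}|$, and the sensitivity of $f$ is $s(f)=\max_x s(f,x)$. Index the variables of $f:\{0,1\}^{n^k}\rightarrow\{0,1\}$ by tuples $(i_1,\dots,i_k)\in[n]^k$, where $[n]=\{1,\dots,n\}$ (so an input encodes a $k$-partite $k$-uniform hypergraph with $n$ vertices in each part). The function $f$ is called a $k$-partite $k$-uniform hypergraph property if for every input $x=(x_{(i_1,\dots,i_k)})$ and all permutations $\sigma_1,\dots,\sigma_k\in S_n$, $f\big((x_{(i_1,\dots,i_k)})_{(i_1,\dots,i_k)}\big)=f\big((x_{(\sigma_1(i_1),\dots,\sigma_k(i_k))})_{(i_1,\dots,i_k)}\big)$. -}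

module Defs where

open import Data.Bool.Base using (Bool; true; false; not)
open import Data.Bool.Properties using (_≟_)
open import Data.Fin.Base using (Fin; funToFin; finToFun)
open import Data.Fin.Permutation using (Permutation′; _⟨$⟩ʳ_)
open import Data.List.Base as List using (List; _++_; filter; length; allFin)
open import Data.List.Extrema.Nat using (max; max≤v⁺; v≤max⁺)
open import Data.List.Membership.Propositional using (_∈_; lose)
open import Data.List.Membership.Propositional.Properties
  using (∈-map⁺; ∈-++⁺ˡ; ∈-++⁺ʳ)
open import Data.List.Relation.Unary.All.Properties using (map⁺)
open import Data.List.Relation.Unary.Any using (here)
import Data.List.Relation.Unary.All as All
open import Data.Nat.Base using (ℕ; zero; suc; _+_; _*_; _^_; _≤_; _/_; z≤n; s≤s⁻¹)
open import Data.Nat.Properties using (≤-refl; module ≤-Reasoning;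
  +-monoˡ-≤; +-cancelʳ-≤; +-comm)
open import Data.Nat.DivMod using (_%_; m≡m%n+[m/n]*n; m%n<n; /-mono-≤; m*n/n≡m;
  +-distrib-/-∣ˡ)
open import Data.Nat.Divisibility using (n∣m*n)
open import Data.Product.Base using (∃₂)
open import Data.Sum.Base using (inj₂)
open import Data.Vec.Base using (Vec; []; _∷_; lookup; tabulate; updateAt)
open import Relation.Binary.PropositionalEquality using (_≡_; _≢_; refl)
open import Relation.Nullary.Decidable using (¬?)

Input : ℕ → Set
Input N = Vec Bool N

BooleanFunction : ℕ → Set
BooleanFunction N = Input N → Bool

flipBit : ∀ {N} → Input N → Fin N → Input N
flipBit x i = updateAt x i not

sensitivityAt : ∀ {N} → BooleanFunction N → Input N → ℕ
sensitivityAt {N} f x =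
  length (filter (λ i → ¬? (f x ≟ f (flipBit x i))) (allFin N))

allInputs : ∀ N → List (Input N)
allInputs zero    = List.[ [] ]
allInputs (suc N) =
  List.map (false ∷_) (allInputs N) ++ List.map (true ∷_) (allInputs N)

∈-allInputs : ∀ {N} (x : Input N) → x ∈ allInputs N
∈-allInputs []          = here refl
∈-allInputs (false ∷ x) = ∈-++⁺ˡ (∈-map⁺ (false ∷_) (∈-allInputs x))
∈-allInputs (true  ∷ x) = ∈-++⁺ʳ _ (∈-map⁺ (true ∷_) (∈-allInputs x))

-- The default value 0 is harmless: sensitivities are nonnegative and
-- allInputs is never empty.
sensitivity : ∀ {N} → BooleanFunction N → ℕ
sensitivity {N} f = max 0 (List.map (sensitivityAt f) (allInputs N))

sensitivityAt≤sensitivity : ∀ {N} (f : BooleanFunction N) x →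
                            sensitivityAt f x ≤ sensitivity f
sensitivityAt≤sensitivity f x =
  v≤max⁺ 0 _ (inj₂ (lose (∈-map⁺ (sensitivityAt f) (∈-allInputs x)) ≤-refl))

sensitivity-least : ∀ {N} (f : BooleanFunction N) {m} →
                    (∀ x → sensitivityAt f x ≤ m) → sensitivity f ≤ m
sensitivity-least {N} f h = max≤v⁺ z≤n (map⁺ (All.universal h (allInputs N)))

NonConstant : ∀ {N} → BooleanFunction N → Set
NonConstant f = ∃₂ λ x y → f x ≢ f y

-- The input whose bit at (i₁ , … , iₖ) is the bit of x at
-- (σ₁ i₁ , … , σₖ iₖ).  The n ^ k positions stand for the k-tuples over
-- Fin n through the mutually inverse maps finToFun and funToFin.
permuteParts : ∀ {n k} → (Fin k → Permutation′ n) → Input (n ^ k) → Input (n ^ k)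
permuteParts {n} {k} σ x =
  tabulate λ p → lookup x (funToFin λ j → σ j ⟨$⟩ʳ finToFun {n} {k} p j)

IsHypergraphProperty : ∀ n k → BooleanFunction (n ^ k) → Set
IsHypergraphProperty n k f =
  ∀ (x : Input (n ^ k)) (σ : Fin k → Permutation′ n) →
  f x ≡ f (permuteParts {n} {k} σ x)

⌈_/3⌉ : ℕ → ℕ
⌈ k /3⌉ = (k + 2) / 3

k≤⌈k/3⌉*3 : ∀ k → k ≤ ⌈ k /3⌉ * 3
k≤⌈k/3⌉*3 k = +-cancelʳ-≤ 2 k _ (begin
  k + 2                              ≡⟨ m≡m%n+[m/n]*n (k + 2) 3 ⟩
  (k + 2) % 3 + ⌈ k /3⌉ * 3          ≤⟨ +-monoˡ-≤ _ (s≤s⁻¹ (m%n<n (k + 2) 3)) ⟩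
  2 + ⌈ k /3⌉ * 3                    ≡⟨ +-comm 2 _ ⟩
  ⌈ k /3⌉ * 3 + 2                    ∎)
  where open ≤-Reasoning

⌈k/3⌉-least : ∀ k q → k ≤ q * 3 → ⌈ k /3⌉ ≤ q
⌈k/3⌉-least k q k≤q*3 = begin
  (k + 2) / 3          ≤⟨ /-mono-≤ (+-monoˡ-≤ 2 k≤q*3) ≤-refl ⟩
  (q * 3 + 2) / 3      ≡⟨ +-distrib-/-∣ˡ 2 (n∣m*n q) ⟩
  q * 3 / 3 + 0        ≡⟨ +-comm (q * 3 / 3) 0 ⟩
  q * 3 / 3            ≡⟨ m*n/n≡m q 3 ⟩
  q                    ∎
  where open ≤-Reasoning

{-# OPTIONS --safe #-}
-- Cut the k coordinates into three groups of sizes a, d, d with d = ⌈k/3⌉ and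
-- a = k ∸ 2d ≤ d, so that an input becomes a stack of n^a Boolean matrices.
-- The function asks whether some matrix contains a pattern: 4 rows R and 12
-- columns Γ, three columns per row, such that each column of Γ is the indicator
-- of the row owning it and each row of R is 1 outside Γ.  A pattern is witnessed
-- by the entries on its lines, which bounds the sensitivity at 1-inputs by
-- 4 n^d + 12 n^d.  Two matrices with patterns that differ in at most two entries
-- have the same rows, columns and owners, hence agree on the lines of the
-- pattern: any discrepancy would force a third differing entry.  Therefore a
-- 0-input has at most one sensitive bit per matrix, at most n^a ≤ n^d in total.
-- For n < 12, where the pattern may not fit, any non-constant property works,
-- since n^k is bounded.
module Submission where

open import Defs
open import Data.Bool.Base using (Bool; true; false)
import Data.Bool.Properties as Bool
open import Data.Empty using (⊥)
open import Data.Fin.Base using (Fin; zero; suc; combine; quotient; remainder; punchIn;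
  join; splitAt; inject≤; finToFun; funToFin; fromℕ<; _↑ˡ_; _↑ʳ_)
open import Data.Fin.Permutation as Perm using (Permutation′; permutation; flip; _⟨$⟩ʳ_; _⟨$⟩ˡ_)
open import Data.Fin.Properties using (_≟_; any?; all?; pigeonhole; injective⇒≤; <⇒≢;
  remQuot-combine; combine-remQuot; combine-injective; combine-injectiveʳ;
  punchIn-injective; punchInᵢ≢i; inject≤-injective; splitAt-join;
  splitAt-↑ˡ; splitAt-↑ʳ; splitAt⁻¹-↑ˡ; splitAt⁻¹-↑ʳ; finToFun-funToFin; funToFin-finToFin)
open import Data.List.Base as List using (List; _∷_; filter; allFin)
open import Data.List.Membership.Propositional.Properties using (∈-lookup)
import Data.List.Relation.Unary.All as All
open import Data.List.Relation.Unary.All.Properties using (all-filter)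
open import Data.List.Relation.Unary.AllPairs using (_∷_)
open import Data.List.Relation.Unary.Unique.Propositional using (Unique)
open import Data.List.Relation.Unary.Unique.Propositional.Properties using (allFin⁺; filter⁺)
open import Data.Nat.Base using (ℕ; zero; suc; NonZero; _+_; _*_; _^_; _∸_; _≤_; _<_; z≤n; s≤s;
  ⌊_/2⌋; ⌈_/2⌉)
import Data.Nat.Properties as ℕ
open import Data.Product.Base using (∃; Σ-syntax; _×_; _,_; proj₁; proj₂; uncurry)
open import Data.Product.Function.NonDependent.Propositional using (_×-↔_)
open import Data.Product.Properties using (≡-dec)
open import Data.Sum.Base using (_⊎_; inj₁; inj₂; [_,_]′)
open import Data.Sum.Properties using (inj₁-injective; inj₂-injective)
open import Data.Vec.Base using (lookup; tabulate; replicate)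
open import Data.Vec.Properties using (lookup∘tabulate; lookup∘updateAt′; lookup-replicate)
open import Function.Base using (_∘_; id)
open import Function.Bundles using (_↔_; _⇔_; mk⇔; Injection; Inverse; mk↔ₛ′)
open import Function.Construct.Composition using (_↔-∘_)
open import Function.Construct.Identity using (↔-id)
open import Function.Definitions using (Injective)
open import Function.Properties.Inverse using (↔⇒↣)
open import Relation.Binary.PropositionalEquality
  using (_≡_; _≢_; _≗_; refl; sym; trans; cong; cong₂; subst)
open import Relation.Nullary using (¬_; Dec; does; yes; no; contradiction)
open import Relation.Nullary.Decidable using (map′; ¬?; _×-dec_; _⊎-dec_; _→-dec_;
  dec-true; dec-false; does-⇔; decidable-stable)
open import Relation.Unary using (Decidable)

private variable
  B C : ℕ

-- Patterns in a Boolean matrix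

Matrix : ℕ → ℕ → Set
Matrix B C = Fin B → Fin C → Bool

opaque
  -- Columns are numbered by pairs of a row and one of three ranks. A row owns three columns, and a
  -- column has three rows besides its owner: one more than the two entries in which the compared
  -- matrices may differ.
  owner : Fin 12 → Fin 4
  owner = quotient {4} 3

  rank : Fin 12 → Fin 3
  rank = remainder {4} 3

  owned : Fin 4 → Fin 3 → Fin 12
  owned = combine

  owner-owned : ∀ i e → owner (owned i e) ≡ i
  owner-owned i e = cong proj₁ (remQuot-combine i e)

  owned-injective : ∀ i {e e′} → owned i e ≡ owned i e′ → e ≡ e′
  owned-injective i eq = combine-injectiveʳ {4} {3} i _ i _ eq

  owner-rank-injective : ∀ {j j′} → owner j ≡ owner j′ → rank j ≡ rank j′ → j ≡ j′
  owner-rank-injective {j} {j′} p q =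
    trans (sym (combine-remQuot {4} 3 j)) (trans (cong₂ combine p q) (combine-remQuot {4} 3 j′))

record Pattern (M : Matrix B C) (R : Fin 4 → Fin B) (Γ : Fin 12 → Fin C) : Set where
  field
    R-injective : Injective _≡_ _≡_ R
    Γ-injective : Injective _≡_ _≡_ Γ
    own         : ∀ j → M (R (owner j)) (Γ j) ≡ true
    other       : ∀ j r → r ≢ R (owner j) → M r (Γ j) ≡ false
    outside     : ∀ i c → (∀ j → Γ j ≢ c) → M (R i) c ≡ true

  other-row : ∀ {i j} → i ≢ owner j → M (R i) (Γ j) ≡ false
  other-row {i} {j} i≢ = other j (R i) (i≢ ∘ R-injective)

-- The certificate of a pattern: every field of `Pattern` reads the matrix only at these positions.
OnLine : (Fin 4 → Fin B) → (Fin 12 → Fin C) → Fin B → Fin C → Set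
OnLine R Γ r c = (∃ λ i → R i ≡ r) ⊎ (∃ λ j → Γ j ≡ c)

-- The maps `β` and `γ` lead from the new matrix back to the old one. Their injectivity carries the
-- premises of `other` and `outside` across. The uses are a change of matrix off the lines,
-- pointwise equal `R` and `Γ`, and permutations of rows and columns.
Pattern-transport :
  ∀ {B C B′ C′} {M : Matrix B C} {M′ : Matrix B′ C′} {R Γ R′ Γ′}
  (β : Fin B′ → Fin B) (γ : Fin C′ → Fin C) →
  Injective _≡_ _≡_ β → Injective _≡_ _≡_ γ →
  (∀ i → β (R′ i) ≡ R i) → (∀ j → γ (Γ′ j) ≡ Γ j) →
  (∀ {r c} → OnLine R′ Γ′ r c → M′ r c ≡ M (β r) (γ c)) →
  Pattern M R Γ → Pattern M′ R′ Γ′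
Pattern-transport {M = M} {M′} {R} {Γ} {R′} {Γ′} β γ β-inj γ-inj βR γΓ M≡ P = record
  { R-injective = λ {i} {j} eq → R-injective (trans (sym (βR i)) (trans (cong β eq) (βR j)))
  ; Γ-injective = λ {i} {j} eq → Γ-injective (trans (sym (γΓ i)) (trans (cong γ eq) (γΓ j)))
  ; own = λ j → trans (M≡ (inj₂ (j , refl))) (trans (cong₂ M (βR _) (γΓ j)) (own j))
  ; other = λ j r r≢ → trans (M≡ (inj₂ (j , refl))) (trans (cong (M (β r)) (γΓ j))
      (other j (β r) λ eq → r≢ (β-inj (trans eq (sym (βR _))))))
  ; outside = λ i c c∉ → trans (M≡ (inj₁ (i , refl))) (trans (cong (λ r → M r (γ c)) (βR i))
      (outside i (γ c) λ j eq → c∉ j (γ-inj (trans (γΓ j) eq))))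
  }
  where open Pattern P

Pattern-agree : {M M′ : Matrix B C} → ∀ {R Γ} → (∀ {r c} → OnLine R Γ r c → M′ r c ≡ M r c) →
                Pattern M R Γ → Pattern M′ R Γ
Pattern-agree = Pattern-transport id id id id (λ _ → refl) (λ _ → refl)

-- In a column of `Γ` the owner supplies the 1; in any other column all four rows do, and `zero` is
-- picked.
true-in-column : {M : Matrix B C} → ∀ {R Γ} → Pattern M R Γ → ∀ c → ∃ λ i → M (R i) c ≡ true
true-in-column {Γ = Γ} P c with any? (λ j → Γ j ≟ c)
... | yes (j , refl) = owner j , Pattern.own P j
... | no c∉          = zero , Pattern.outside P zero c λ j eq → c∉ (j , eq)

-- Patterns in two matrices that differ in at most two entries

AgreeOff : Matrix B C → Matrix B C → (p q : Fin B × Fin C) → Set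
AgreeOff M M′ p q = ∀ {s} → s ≢ p → s ≢ q → M (proj₁ s) (proj₂ s) ≡ M′ (proj₁ s) (proj₂ s)

AgreeOff-sym : ∀ {M M′ : Matrix B C} {p q} → AgreeOff M M′ p q → AgreeOff M′ M p q
AgreeOff-sym agree s≢p s≢q = sym (agree s≢p s≢q)

true≢false : ∀ {b b′} → b ≡ true → b′ ≡ false → b ≢ b′
true≢false refl refl ()

false≢true : ∀ {b b′} → b ≡ false → b′ ≡ true → b ≢ b′
false≢true refl refl ()

_≟ₚ_ : (s t : Fin B × Fin C) → Dec (s ≡ t)
_≟ₚ_ = ≡-dec _≟_ _≟_

module _ {M M′ : Matrix B C} {p q} (agree : AgreeOff M M′ p q) where

  conflict⇒flip : ∀ {s} → M (proj₁ s) (proj₂ s) ≢ M′ (proj₁ s) (proj₂ s) → s ≡ p ⊎ s ≡ q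
  conflict⇒flip {s} M≢ with s ≟ₚ p | s ≟ₚ q
  ... | yes s≡p | _       = inj₁ s≡p
  ... | no  _   | yes s≡q = inj₂ s≡q
  ... | no s≢p  | no s≢q  = contradiction (agree s≢p s≢q) M≢

  -- Pigeonhole: every conflict sits at `p` or at `q`, so two of the three sites coincide.
  three-conflicts : (s : Fin 3 → Fin B × Fin C) → Injective _≡_ _≡_ s →
                    (∀ e → M (proj₁ (s e)) (proj₂ (s e)) ≢ M′ (proj₁ (s e)) (proj₂ (s e))) → ⊥
  three-conflicts s s-inj M≢ with pigeonhole (ℕ.n<1+n 2) (side ∘ flipped)
    where
    flipped : ∀ e → s e ≡ p ⊎ s e ≡ q
    flipped e = conflict⇒flip (M≢ e)
    side : ∀ {e} → s e ≡ p ⊎ s e ≡ q → Fin 2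
    side (inj₁ _) = zero
    side (inj₂ _) = suc zero
  ... | e , e′ , e<e′ , eq with conflict⇒flip (M≢ e) | conflict⇒flip (M≢ e′)
  ... | inj₁ a | inj₁ b = <⇒≢ e<e′ (s-inj (trans a (sym b)))
  ... | inj₂ a | inj₂ b = <⇒≢ e<e′ (s-inj (trans a (sym b)))

module _ {M M′ : Matrix B C} {p q} (agree : AgreeOff M M′ p q) {R R′ Γ Γ′}
         (P : Pattern M R Γ) (P′ : Pattern M′ R′ Γ′) where
  private
    module P = Pattern P
    module P′ = Pattern P′

  -- If R′ i′ is not a row of P, each of the three columns it owns in P′ is 0 on
  -- all rows of P in M′, but has a 1 there in M.
  rows-shared : ∀ i′ → ∃ λ i → R i ≡ R′ i′
  rows-shared i′ with any? (λ i → R i ≟ R′ i′)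
  ... | yes shared = shared
  ... | no R′∉ = contradiction conflicts (three-conflicts agree site site-inj)
    where
    col : Fin 3 → Fin C
    col e = Γ′ (owned i′ e)
    site : Fin 3 → Fin B × Fin C
    site e = R (proj₁ (true-in-column P (col e))) , col e
    site-inj : Injective _≡_ _≡_ site
    site-inj eq = owned-injective i′ (P′.Γ-injective (cong proj₂ eq))
    conflicts : ∀ e → M (proj₁ (site e)) (proj₂ (site e)) ≢ M′ (proj₁ (site e)) (proj₂ (site e))
    conflicts e = true≢false (proj₂ (true-in-column P (col e)))
      (P′.other _ _ λ eq → R′∉ (_ , trans eq (cong R′ (owner-owned i′ e))))

module _ {M M′ : Matrix B C} {p q} (agree : AgreeOff M M′ p q) {R R′ Γ Γ′}
         (P : Pattern M R Γ) (P′ : Pattern M′ R′ Γ′) where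
  private
    module P = Pattern P
    module P′ = Pattern P′

  -- If Γ j is not a column of P′, it is 1 in M′ on all four shared rows, but 0 in
  -- M on the three that do not own it.
  columns-shared : ∀ j → ∃ λ j′ → Γ′ j′ ≡ Γ j
  columns-shared j with any? (λ j′ → Γ′ j′ ≟ Γ j)
  ... | yes shared = shared
  ... | no Γ∉ = contradiction conflicts (three-conflicts agree site site-inj)
    where
    site : Fin 3 → Fin B × Fin C
    site e = R (punchIn (owner j) e) , Γ j
    site-inj : Injective _≡_ _≡_ site
    site-inj eq = punchIn-injective (owner j) _ _ (P.R-injective (cong proj₁ eq))
    conflicts : ∀ e → M (proj₁ (site e)) (proj₂ (site e)) ≢ M′ (proj₁ (site e)) (proj₂ (site e))
    conflicts e with rows-shared (AgreeOff-sym agree) P′ P (punchIn (owner j) e)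
    ... | i′ , eq = false≢true (P.other-row (punchInᵢ≢i (owner j) e))
      (subst (λ r → M′ r (Γ j) ≡ true) eq (P′.outside i′ (Γ j) λ j′ eq′ → Γ∉ (j′ , eq′)))

module _ {M M′ : Matrix B C} {p q} (agree : AgreeOff M M′ p q) {R R′ Γ Γ′}
         (P : Pattern M R Γ) (P′ : Pattern M′ R′ Γ′) where
  private
    module P = Pattern P
    module P′ = Pattern P′

  -- If the owners differ, both flips lie in the column Γ j.  The three columns
  -- owned by the row R (owner j) in P′ are then unaffected and owned by it in P as
  -- well, so that with Γ j it owns four.
  owners-shared : ∀ {j j′} → Γ j ≡ Γ′ j′ → R (owner j) ≡ R′ (owner j′)
  owners-shared {j} {j′} Γ≡ with R (owner j) ≟ R′ (owner j′)
  ... | yes R≡ = R≡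
  ... | no R≢ = contradiction (injective⇒≤ {f = rank ∘ column} rank-injective) (ℕ.<⇒≱ (ℕ.n<1+n 3))
    where
    conflict : M (R (owner j)) (Γ j) ≢ M′ (R (owner j)) (Γ j)
    conflict = true≢false (P.own j)
      (trans (cong (M′ _) Γ≡) (P′.other j′ _ R≢))
    conflict′ : M (R′ (owner j′)) (Γ j) ≢ M′ (R′ (owner j′)) (Γ j)
    conflict′ = false≢true (P.other j _ (R≢ ∘ sym))
      (trans (cong (M′ _) Γ≡) (P′.own j′))
    -- The two rows claiming this column each yield a conflict in it. The rows are distinct, so the
    -- conflicts are `p` and `q` in some order.
    flips-in-column : proj₂ p ≡ Γ j × proj₂ q ≡ Γ j
    flips-in-column with conflict⇒flip agree conflict | conflict⇒flip agree conflict′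
    ... | inj₁ a | inj₂ b = cong proj₂ (sym a) , cong proj₂ (sym b)
    ... | inj₂ a | inj₁ b = cong proj₂ (sym b) , cong proj₂ (sym a)
    ... | inj₁ a | inj₁ b = contradiction (cong proj₁ (trans a (sym b))) R≢
    ... | inj₂ a | inj₂ b = contradiction (cong proj₁ (trans a (sym b))) R≢
    agree-elsewhere : ∀ r {c} → c ≢ Γ j → M r c ≡ M′ r c
    agree-elsewhere r c≢ = agree
      (λ eq → c≢ (trans (cong proj₂ eq) (proj₁ flips-in-column)))
      (λ eq → c≢ (trans (cong proj₂ eq) (proj₂ flips-in-column)))
    row : ∃ λ i → R′ i ≡ R (owner j)
    row = rows-shared (AgreeOff-sym agree) P′ P (owner j)
    i = proj₁ row
    shared : ∀ e → ∃ λ l → Γ l ≡ Γ′ (owned i e)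
    shared e = columns-shared (AgreeOff-sym agree) P′ P (owned i e)
    -- Otherwise `i` would be `owner j′`, and the two owning rows would be equal.
    elsewhere : ∀ e → Γ′ (owned i e) ≢ Γ j
    elsewhere e eq = R≢ (trans (sym (proj₂ row)) (cong R′ (trans (sym (owner-owned i e))
      (cong owner (P′.Γ-injective (trans eq Γ≡))))))
    column : Fin 4 → Fin 12
    column zero    = j
    column (suc e) = proj₁ (shared e)
    column-injective : Injective _≡_ _≡_ column
    column-injective {zero}  {zero}   eq = refl
    column-injective {zero}  {suc e}  eq =
      contradiction (trans (sym (proj₂ (shared e))) (cong Γ (sym eq))) (elsewhere e)
    column-injective {suc e} {zero}   eq =
      contradiction (trans (sym (proj₂ (shared e))) (cong Γ eq)) (elsewhere e)
    column-injective {suc e} {suc e′} eq = cong suc (owned-injective i (P′.Γ-injective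
      (trans (sym (proj₂ (shared e))) (trans (cong Γ eq) (proj₂ (shared e′))))))
    owner-column : ∀ e → owner (column e) ≡ owner j
    owner-column zero = refl
    -- If another row owned this column in `P`, then `M` would be 0 at the row `R (owner j)`, where
    -- `M′` is 1, although the column contains no flip.
    owner-column (suc e) = decidable-stable (owner (column (suc e)) ≟ owner j) λ owner≢ →
      contradiction (agree-elsewhere (R (owner j)) (elsewhere e)) (false≢true
        (trans (cong (M (R (owner j))) (sym (proj₂ (shared e)))) (P.other-row (owner≢ ∘ sym)))
        (subst (λ r → M′ r (Γ′ (owned i e)) ≡ true)
          (trans (cong R′ (owner-owned i e)) (proj₂ row)) (P′.own (owned i e))))
    rank-injective : Injective _≡_ _≡_ (rank ∘ column)
    rank-injective {e} {e′} eq = column-injective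
      (owner-rank-injective (trans (owner-column e) (sym (owner-column e′))) eq)

  -- The column belongs to both patterns and has the same owning row in both, so each matrix shows
  -- the indicator of that row.
  agree-on-column : ∀ r j → M r (Γ j) ≡ M′ r (Γ j)
  agree-on-column r j with columns-shared agree P P′ j
  ... | j′ , eq with r ≟ R (owner j)
  ... | yes refl = trans (P.own j) (sym (trans (cong₂ M′ (owners-shared (sym eq)) (sym eq)) (P′.own j′)))
  ... | no r≢ = trans (P.other j r r≢) (sym (trans (cong (M′ r) (sym eq))
    (P′.other j′ r λ r≡ → r≢ (trans r≡ (sym (owners-shared (sym eq)))))))

  agree-on-line : ∀ {r c} → OnLine R Γ r c → M r c ≡ M′ r c
  agree-on-line {r} (inj₂ (j , refl)) = agree-on-column r j
  agree-on-line {r} {c} (inj₁ (i , refl)) with any? (λ j → Γ j ≟ c)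
  ... | yes (j , refl) = agree-on-column r j
  -- The row belongs to `P′` too, and `c` avoids the columns of `P′` because these are columns of
  -- `P`. Both entries are therefore 1.
  ... | no c∉ with rows-shared (AgreeOff-sym agree) P′ P i
  ...   | i′ , eq = trans (P.outside i c λ j eq′ → c∉ (j , eq′)) (sym (subst (λ r → M′ r c ≡ true) eq
    (P′.outside i′ c λ j′ eq′ → let j , eq″ = columns-shared (AgreeOff-sym agree) P′ P j′ in
      c∉ (j , trans eq″ eq′))))

-- Bounding sensitivity by injective codes

lookup-injective : ∀ {A : Set} {xs : List A} → Unique xs → Injective _≡_ _≡_ (List.lookup xs)
lookup-injective {xs = _ ∷ _} (_ ∷ _)    {zero}  {zero}  _  = refl
lookup-injective {xs = _ ∷ _} (x∉ ∷ _)   {zero}  {suc j} eq = contradiction eq (All.lookup x∉ (∈-lookup j))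
lookup-injective {xs = _ ∷ _} (x∉ ∷ _)   {suc i} {zero}  eq = contradiction (sym eq) (All.lookup x∉ (∈-lookup i))
lookup-injective {xs = _ ∷ _} (_ ∷ uniq) {suc i} {suc j} eq = cong suc (lookup-injective uniq eq)

-- The sensitive bits form a list without repetition, so looking up and then coding injects its
-- indices into `Fin m`. The code may be read off from the proof of sensitivity, hence its second
-- argument.
sensitivityAt-≤ : ∀ {N m} (f : BooleanFunction N) x (code : ∀ p → f x ≢ f (flipBit x p) → Fin m) →
                  (∀ {p q} s t → code p s ≡ code q t → p ≡ q) → sensitivityAt f x ≤ m
sensitivityAt-≤ {N} f x code code-injective =
  injective⇒≤ {f = λ e → code (List.lookup bits e) (All.lookup sensitive (∈-lookup e))}
    (lookup-injective (filter⁺ sensitive? (allFin⁺ N)) ∘ code-injective _ _)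
  where
  sensitive? : Decidable (λ p → f x ≢ f (flipBit x p))
  sensitive? p = ¬? (f x Bool.≟ f (flipBit x p))
  bits = filter sensitive? (allFin N)
  sensitive = all-filter sensitive? (allFin N)

module _ {N m : ℕ} {Q : Input N → Set} (Q? : ∀ x → Dec (Q x)) where

  sensitivityAt-yes : ∀ {x} → Q x → (code : ∀ p → ¬ Q (flipBit x p) → Fin m) →
                      (∀ {p q} s t → code p s ≡ code q t → p ≡ q) → sensitivityAt (does ∘ Q?) x ≤ m
  sensitivityAt-yes {x} Qx code code-injective =
    sensitivityAt-≤ (does ∘ Q?) x (λ p → code p ∘ lost p) λ s t → code-injective (lost _ s) (lost _ t)
    where
    lost : ∀ p → does (Q? x) ≢ does (Q? (flipBit x p)) → ¬ Q (flipBit x p)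
    lost p s Qy = s (trans (dec-true (Q? x) Qx) (sym (dec-true (Q? (flipBit x p)) Qy)))

  sensitivityAt-no : ∀ {x} → ¬ Q x → (code : ∀ p → Q (flipBit x p) → Fin m) →
                     (∀ {p q} s t → code p s ≡ code q t → p ≡ q) → sensitivityAt (does ∘ Q?) x ≤ m
  sensitivityAt-no {x} ¬Qx code code-injective =
    sensitivityAt-≤ (does ∘ Q?) x (λ p → code p ∘ gained p) λ s t → code-injective (gained _ s) (gained _ t)
    where
    gained : ∀ p → does (Q? x) ≢ does (Q? (flipBit x p)) → Q (flipBit x p)
    gained p s = decidable-stable (Q? (flipBit x p)) λ ¬Qy →
      s (trans (dec-false (Q? x) ¬Qx) (sym (dec-false (Q? (flipBit x p)) ¬Qy)))

-- Deciding patterns and coding the entries on their lines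

-- The search runs over the codes of functions. Decoding returns a function only up to pointwise
-- equality, which is why `P` must respect it.
any-function? : ∀ {m n} {P : (Fin m → Fin n) → Set} → (∀ {f g} → f ≗ g → P f → P g) →
                (∀ f → Dec (P f)) → Dec (∃ P)
any-function? resp P? = map′ (λ (u , Pu) → finToFun u , Pu)
  (λ (f , Pf) → funToFin f , resp (sym ∘ finToFun-funToFin f) Pf) (any? (P? ∘ finToFun))

injective? : ∀ {m n} (f : Fin m → Fin n) → Dec (∀ i j → f i ≡ f j → i ≡ j)
injective? f = all? λ i → all? λ j → (f i ≟ f j) →-dec (i ≟ j)

pattern? : ∀ {B C} (M : Matrix B C) R Γ → Dec (Pattern M R Γ)
pattern? M R Γ = map′
  (λ (a , b , c , d , e) → record
    { R-injective = a _ _ ; Γ-injective = b _ _ ; own = c ; other = d ; outside = e })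
  (λ P → let open Pattern P in (λ _ _ → R-injective) , (λ _ _ → Γ-injective) , own , other , outside)
  (injective? R ×-dec injective? Γ ×-dec
   (all? λ j → M (R (owner j)) (Γ j) Bool.≟ true) ×-dec
   (all? λ j → all? λ r → ¬? (r ≟ R (owner j)) →-dec (M r (Γ j) Bool.≟ false)) ×-dec
   (all? λ i → all? λ c → (all? λ j → ¬? (Γ j ≟ c)) →-dec (M (R i) c Bool.≟ true)))

onLine? : ∀ {B C} R Γ (r : Fin B) (c : Fin C) → Dec (OnLine R Γ r c)
onLine? R Γ r c = any? (λ i → R i ≟ r) ⊎-dec any? (λ j → Γ j ≟ c)

-- Four rows of `C` entries and twelve columns of `B` entries. An entry at a crossing can receive a
-- code of either sort, depending on the proof.
line-code : ∀ {B C R Γ} {r : Fin B} {c : Fin C} → OnLine R Γ r c → Fin (4 * C + 12 * B)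
line-code {B} {C} {c = c} (inj₁ (i , _)) = join (4 * C) (12 * B) (inj₁ (combine i c))
line-code {B} {C} {r = r} (inj₂ (j , _)) = join (4 * C) (12 * B) (inj₂ (combine j r))

join-injective : ∀ m n {s t} → join m n s ≡ join m n t → s ≡ t
join-injective m n {s} {t} eq =
  trans (sym (splitAt-join m n s)) (trans (cong (splitAt m) eq) (splitAt-join m n t))

line-code-injective : ∀ {B C R Γ} {r r′ : Fin B} {c c′ : Fin C}
                      (l : OnLine R Γ r c) (l′ : OnLine R Γ r′ c′) →
                      line-code l ≡ line-code l′ → (r , c) ≡ (r′ , c′)
line-code-injective {B} {C} {c = c} {c′} (inj₁ (i , refl)) (inj₁ (i′ , refl)) eq
  with refl , refl ← combine-injective i c i′ c′ (inj₁-injective (join-injective (4 * C) (12 * B) eq)) = refl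
line-code-injective {B} {C} {r = r} {r′} (inj₂ (j , refl)) (inj₂ (j′ , refl)) eq
  with refl , refl ← combine-injective j r j′ r′ (inj₂-injective (join-injective (4 * C) (12 * B) eq)) = refl
line-code-injective {B} {C} (inj₁ _) (inj₂ _) eq with () ← join-injective (4 * C) (12 * B) {inj₁ _} {inj₂ _} eq
line-code-injective {B} {C} (inj₂ _) (inj₁ _) eq with () ← join-injective (4 * C) (12 * B) {inj₂ _} {inj₁ _} eq

-- A matrix with a pattern

pattern-exists : ∀ {B C} → 4 ≤ B → 12 ≤ C → ∃ λ (M : Matrix B C) → ∃ λ R → ∃ (Pattern M R)
pattern-exists {B} {C} 4≤B 12≤C = M , R , Γ , record
  { R-injective = R-inj ; Γ-injective = Γ-inj ; own = own ; other = other ; outside = outside }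
  where
  R : Fin 4 → Fin B
  R i = inject≤ i 4≤B
  Γ : Fin 12 → Fin C
  Γ j = inject≤ j 12≤C
  R-inj : Injective _≡_ _≡_ R
  R-inj = inject≤-injective 4≤B 4≤B _ _
  Γ-inj : Injective _≡_ _≡_ Γ
  Γ-inj = inject≤-injective 12≤C 12≤C _ _
  column? : ∀ c → Dec (∃ λ j → Γ j ≡ c)
  column? c = any? λ j → Γ j ≟ c
  -- The decision is an argument so that `entry-Γ` can treat any index it might return; injectivity
  -- of `Γ` makes the choice immaterial.
  entry : ∀ r {c} → Dec (∃ λ j → Γ j ≡ c) → Bool
  entry r (yes (j , _)) = does (r ≟ R (owner j))
  entry r (no _)        = true
  M : Matrix B C
  M r c = entry r (column? c)
  entry-Γ : ∀ r j (d : Dec (∃ λ j′ → Γ j′ ≡ Γ j)) → entry r d ≡ does (r ≟ R (owner j))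
  entry-Γ r j (yes (j′ , eq)) = cong (λ l → does (r ≟ R (owner l))) (Γ-inj eq)
  entry-Γ r j (no Γ∉)         = contradiction (j , refl) Γ∉
  own : ∀ j → M (R (owner j)) (Γ j) ≡ true
  own j = trans (entry-Γ (R (owner j)) j (column? (Γ j))) (dec-true (R (owner j) ≟ R (owner j)) refl)
  other : ∀ j r → r ≢ R (owner j) → M r (Γ j) ≡ false
  other j r r≢ = trans (entry-Γ r j (column? (Γ j))) (dec-false (r ≟ R (owner j)) r≢)
  outside : ∀ i c → (∀ j → Γ j ≢ c) → M (R i) c ≡ true
  outside i c c∉ with column? c
  ... | yes (j , eq) = contradiction eq (c∉ j)
  ... | no _         = refl

-- The pattern function on a stack of matrices

module Tensor {N A B C} (coords : Fin N ↔ (Fin A × Fin B × Fin C)) where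
  open Inverse coords using (to; from; strictlyInverseˡ; inverseˡ)

  from⇒to : ∀ {p s} → from s ≡ p → s ≡ to p
  from⇒to eq = sym (inverseˡ (sym eq))

  slice : Input N → Fin A → Matrix B C
  slice x i r c = lookup x (from (i , r , c))

  SlicePattern : Input N → Fin A → Set
  SlicePattern x i = ∃ λ R → ∃ λ Γ → Pattern (slice x i) R Γ

  HasPattern : Input N → Set
  HasPattern x = ∃ (SlicePattern x)

  opaque
    hasPattern? : ∀ x → Dec (HasPattern x)
    hasPattern? x = any? λ i →
      any-function? (λ R≗ (Γ , P) → Γ , Pattern-transport id id id id (sym ∘ R≗) (λ _ → refl) (λ _ → refl) P) λ R →
      any-function? (λ Γ≗ → Pattern-transport id id id id (λ _ → refl) (sym ∘ Γ≗) (λ _ → refl)) λ Γ →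
      pattern? (slice x i) R Γ

  existsPattern : BooleanFunction N
  existsPattern = does ∘ hasPattern?

  slice-flipBit : ∀ x p {i r c} → from (i , r , c) ≢ p → slice (flipBit x p) i r c ≡ slice x i r c
  slice-flipBit x p ≢p = lookup∘updateAt′ _ p ≢p x

  -- The flip leaves all other slices unchanged, so a pattern in one of them would already occur in
  -- `x`.
  pattern-in-flipped-slice : ∀ {x p} → ¬ HasPattern x → HasPattern (flipBit x p) →
                             SlicePattern (flipBit x p) (proj₁ (to p))
  pattern-in-flipped-slice {x} {p} ¬x (i , R , Γ , P) with i ≟ proj₁ (to p)
  ... | yes refl = R , Γ , P
  ... | no i≢ = contradiction
    (i , R , Γ , Pattern-agree (λ _ → sym (slice-flipBit x p λ eq → i≢ (cong proj₁ (from⇒to eq)))) P) ¬x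

  -- Suppose `p` and `q` differ. The inputs flipped at `p` and at `q` agree on the lines of the
  -- first pattern. If `p` lies on such a line, the flip at `q` leaves the bit of `x` there, so `x`
  -- agrees with its flip at `p` as well. Hence `x` has the pattern.
  flips-coincide : ∀ {x i p q} → ¬ HasPattern x →
                   SlicePattern (flipBit x p) i → SlicePattern (flipBit x q) i → p ≡ q
  flips-coincide {x} {i} {p} {q} ¬x (R , Γ , P) (R′ , Γ′ , P′) = decidable-stable (p ≟ q) λ p≢q →
    ¬x (i , R , Γ , Pattern-agree (unflipped p≢q) P)
    where
    away : ∀ {o r c} → (r , c) ≢ proj₂ (to o) → from (i , r , c) ≢ o
    away ≢o eq = ≢o (cong proj₂ (from⇒to eq))
    agree : AgreeOff (slice (flipBit x p) i) (slice (flipBit x q) i) (proj₂ (to p)) (proj₂ (to q))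
    agree ≢p ≢q = trans (slice-flipBit x p (away ≢p)) (sym (slice-flipBit x q (away ≢q)))
    unflipped : p ≢ q → ∀ {r c} → OnLine R Γ r c → slice x i r c ≡ slice (flipBit x p) i r c
    unflipped p≢q {r} {c} l with from (i , r , c) ≟ p
    ... | no ≢p    = sym (slice-flipBit x p ≢p)
    ... | yes refl = trans (sym (slice-flipBit x q p≢q)) (sym (agree-on-line agree P P′ l))

  -- A flip in another slice or off the lines leaves the certificate of the pattern intact.
  sensitive⇒line : ∀ {x i R Γ p} → Pattern (slice x i) R Γ → ¬ HasPattern (flipBit x p) →
                   i ≡ proj₁ (to p) × uncurry (OnLine R Γ) (proj₂ (to p))
  sensitive⇒line {x} {i} {R} {Γ} {p} P ¬y =
    decidable-stable ((i ≟ proj₁ (to p)) ×-dec onLine? R Γ _ _) λ off →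
    ¬y (i , R , Γ , Pattern-agree (λ l → slice-flipBit x p λ eq →
      off (cong proj₁ (from⇒to eq) , subst (uncurry (OnLine R Γ)) (cong proj₂ (from⇒to eq)) l)) P)

  -- At a 1-input a sensitive bit is coded by its place on the lines of one fixed pattern, at a
  -- 0-input by its slice, which determines it by `flips-coincide`.
  sensitivity-existsPattern : ∀ {m} → A ≤ m → 4 * C + 12 * B ≤ m → sensitivity existsPattern ≤ m
  sensitivity-existsPattern {m} A≤m BC≤m = sensitivity-least existsPattern λ x → bound x (hasPattern? x)
    where
    bound : ∀ x → Dec (HasPattern x) → sensitivityAt existsPattern x ≤ m
    bound x (yes (i , R , Γ , P)) = ℕ.≤-trans
      (sensitivityAt-yes hasPattern? (i , R , Γ , P) (λ p ¬y → line-code (proj₂ (line ¬y)))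
        λ s t eq → Injection.injective (↔⇒↣ coords) (cong₂ _,_ (trans (sym (proj₁ (line s))) (proj₁ (line t)))
          (line-code-injective (proj₂ (line s)) (proj₂ (line t)) eq)))
      BC≤m
      where
      line : ∀ {p} → ¬ HasPattern (flipBit x p) → i ≡ proj₁ (to p) × uncurry (OnLine R Γ) (proj₂ (to p))
      line {p} = sensitive⇒line {x} {i} {R} {Γ} {p} P
    bound x (no ¬x) = ℕ.≤-trans
      (sensitivityAt-no hasPattern? ¬x (λ p _ → proj₁ (to p))
        λ {p} {q} s t eq → flips-coincide {x} ¬x
          (subst (SlicePattern (flipBit x p)) eq (pattern-in-flipped-slice {x} {p} ¬x s))
          (pattern-in-flipped-slice {x} {q} ¬x t))
      A≤m

  HasPattern-permute : ∀ {x y} (α : Permutation′ A) (β : Permutation′ B) (γ : Permutation′ C) →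
                       (∀ i r c → slice y i r c ≡ slice x (α ⟨$⟩ʳ i) (β ⟨$⟩ʳ r) (γ ⟨$⟩ʳ c)) →
                       HasPattern x → HasPattern y
  HasPattern-permute {x} α β γ y≡ (i , R , Γ , P) = α ⟨$⟩ˡ i , (β ⟨$⟩ˡ_) ∘ R , (γ ⟨$⟩ˡ_) ∘ Γ ,
    Pattern-transport (β ⟨$⟩ʳ_) (γ ⟨$⟩ʳ_) (Injection.injective (↔⇒↣ β)) (Injection.injective (↔⇒↣ γ))
      (λ _ → Perm.inverseʳ β) (λ _ → Perm.inverseʳ γ)
      (λ {r} {c} _ → trans (y≡ _ r c) (cong (λ i → slice x i (β ⟨$⟩ʳ r) (γ ⟨$⟩ʳ c)) (Perm.inverseʳ α))) P

  HasPattern-⇔ : ∀ {x y} (α : Permutation′ A) (β : Permutation′ B) (γ : Permutation′ C) →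
                 (∀ i r c → slice y i r c ≡ slice x (α ⟨$⟩ʳ i) (β ⟨$⟩ʳ r) (γ ⟨$⟩ʳ c)) →
                 HasPattern x ⇔ HasPattern y
  HasPattern-⇔ {x} {y} α β γ y≡ = mk⇔ (HasPattern-permute {x} {y} α β γ y≡)
    (HasPattern-permute {y} {x} (flip α) (flip β) (flip γ) λ i r c → sym (trans
      (y≡ (α ⟨$⟩ˡ i) (β ⟨$⟩ˡ r) (γ ⟨$⟩ˡ c))
      (trans (cong₂ (λ i r → slice x i r (γ ⟨$⟩ʳ (γ ⟨$⟩ˡ c))) (Perm.inverseʳ α) (Perm.inverseʳ β))
        (cong (slice x i r) (Perm.inverseʳ γ)))))

  HasPattern-constant-false : ¬ HasPattern (replicate N false)
  HasPattern-constant-false (i , R , Γ , P) =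
    true≢false (Pattern.own P zero) (lookup-replicate (from (i , R (owner zero) , Γ zero)) false) refl

  HasPattern-tabulate : ∀ M i → ∃ (λ R → ∃ (Pattern M R)) →
                        HasPattern (tabulate λ p → uncurry M (proj₂ (to p)))
  HasPattern-tabulate M i (R , Γ , P) = i , R , Γ , Pattern-agree
    (λ _ → trans (lookup∘tabulate _ (from _)) (cong (uncurry M ∘ proj₂) (strictlyInverseˡ _))) P

  existsPattern-nonConstant : Fin A → 4 ≤ B → 12 ≤ C → NonConstant existsPattern
  existsPattern-nonConstant i 4≤B 12≤C with pattern-exists 4≤B 12≤C
  ... | M , RΓP = tabulate (λ p → uncurry M (proj₂ (to p))) , replicate N false ,
    true≢false (dec-true (hasPattern? _) (HasPattern-tabulate M i RΓP))
      (dec-false (hasPattern? _) HasPattern-constant-false)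

-- Groups of coordinates and permutations of the parts

funToFin-cong : ∀ {m n} {f g : Fin m → Fin n} → f ≗ g → funToFin f ≡ funToFin g
funToFin-cong {zero}  f≗g = refl
funToFin-cong {suc m} f≗g = cong₂ combine (f≗g zero) (funToFin-cong (f≗g ∘ suc))

module _ {n k} (σ : Fin k → Permutation′ n) where

  -- The map on positions used by `permuteParts`, together with its inverse.
  permuteTuples : Permutation′ (n ^ k)
  permuteTuples = permutation
    (λ p → funToFin λ j → σ j ⟨$⟩ʳ finToFun {n} {k} p j)
    (λ p → funToFin λ j → σ j ⟨$⟩ˡ finToFun {n} {k} p j)
    (λ p → trans (funToFin-cong λ j →
      trans (cong (σ j ⟨$⟩ʳ_) (finToFun-funToFin _ j)) (Perm.inverseʳ (σ j))) (funToFin-finToFin {k} {n} p))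
    (λ p → trans (funToFin-cong λ j →
      trans (cong (σ j ⟨$⟩ˡ_) (finToFun-funToFin _ j)) (Perm.inverseˡ (σ j))) (funToFin-finToFin {k} {n} p))

-- Positions are split by way of tuples, so that permutations of the parts act on the two halves
-- separately, as `permuteTuples-+` records.
^-+-↔ : ∀ n a b → Fin (n ^ (a + b)) ↔ (Fin (n ^ a) × Fin (n ^ b))
^-+-↔ n a b = mk↔ₛ′ to from
  (λ (u , v) → cong₂ _,_
    (trans (funToFin-cong λ j → trans (finToFun-funToFin (append u v) (j ↑ˡ b))
      (cong [ finToFun {n} {a} u , finToFun {n} {b} v ]′ (splitAt-↑ˡ a j b))) (funToFin-finToFin {a} {n} u))
    (trans (funToFin-cong λ j → trans (finToFun-funToFin (append u v) (a ↑ʳ j))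
      (cong [ finToFun {n} {a} u , finToFun {n} {b} v ]′ (splitAt-↑ʳ a b j))) (funToFin-finToFin {b} {n} v)))
  (λ p → trans (funToFin-cong (append-to p)) (funToFin-finToFin {a + b} {n} p))
  where
  append : Fin (n ^ a) → Fin (n ^ b) → Fin (a + b) → Fin n
  append u v = [ finToFun u , finToFun v ]′ ∘ splitAt a
  to : Fin (n ^ (a + b)) → Fin (n ^ a) × Fin (n ^ b)
  to p = funToFin (λ j → finToFun {n} {a + b} p (j ↑ˡ b)) , funToFin (λ j → finToFun {n} {a + b} p (a ↑ʳ j))
  from : Fin (n ^ a) × Fin (n ^ b) → Fin (n ^ (a + b))
  from (u , v) = funToFin (append u v)
  append-to : ∀ p → uncurry append (to p) ≗ finToFun p
  append-to p j with splitAt a j in eq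
  ... | inj₁ i = trans (finToFun-funToFin _ i) (cong (finToFun p) (splitAt⁻¹-↑ˡ eq))
  ... | inj₂ i = trans (finToFun-funToFin _ i) (cong (finToFun p) (splitAt⁻¹-↑ʳ eq))

permuteTuples-+ : ∀ {n} a b (σ : Fin (a + b) → Permutation′ n) u v →
  permuteTuples σ ⟨$⟩ʳ Inverse.from (^-+-↔ n a b) (u , v) ≡
  Inverse.from (^-+-↔ n a b) (permuteTuples (σ ∘ (_↑ˡ b)) ⟨$⟩ʳ u , permuteTuples (σ ∘ (a ↑ʳ_)) ⟨$⟩ʳ v)
permuteTuples-+ {n} a b σ u v = funToFin-cong λ j → trans (cong (σ j ⟨$⟩ʳ_) (finToFun-funToFin _ j)) (pointwise j)
  where
  pointwise : ∀ j → σ j ⟨$⟩ʳ [ finToFun u , finToFun v ]′ (splitAt a j) ≡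
    [ finToFun (permuteTuples (σ ∘ (_↑ˡ b)) ⟨$⟩ʳ u) , finToFun (permuteTuples (σ ∘ (a ↑ʳ_)) ⟨$⟩ʳ v) ]′ (splitAt a j)
  pointwise j with splitAt a j in eq
  ... | inj₁ i = trans (cong (λ j → σ j ⟨$⟩ʳ finToFun u i) (sym (splitAt⁻¹-↑ˡ eq))) (sym (finToFun-funToFin _ i))
  ... | inj₂ i = trans (cong (λ j → σ j ⟨$⟩ʳ finToFun v i) (sym (splitAt⁻¹-↑ʳ eq))) (sym (finToFun-funToFin _ i))

module _ (n a b c : ℕ) where

  tensor : Fin (n ^ (a + (b + c))) ↔ (Fin (n ^ a) × Fin (n ^ b) × Fin (n ^ c))
  tensor = (↔-id _ ×-↔ ^-+-↔ n b c) ↔-∘ ^-+-↔ n a (b + c)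

  open Tensor tensor

  -- Splitting twice turns the permutations of the parts into one permutation each of slices, rows
  -- and columns, and these preserve patterns.
  existsPattern-property : IsHypergraphProperty n (a + (b + c)) existsPattern
  existsPattern-property x σ = does-⇔
    (HasPattern-⇔ {x} {permuteParts σ x} (permuteTuples σᵃ) (permuteTuples σᵇ) (permuteTuples σᶜ)
      λ i r s → trans (lookup∘tabulate _ (Inverse.from tensor (i , r , s)))
        (cong (lookup x) (trans (permuteTuples-+ a (b + c) σ i _)
          (cong (λ w → Inverse.from (^-+-↔ n a (b + c)) (permuteTuples σᵃ ⟨$⟩ʳ i , w))
            (permuteTuples-+ b c σᵇᶜ r s)))))
    (hasPattern? x) (hasPattern? (permuteParts σ x))
    where
    σᵃ : Fin a → Permutation′ n
    σᵃ = σ ∘ (_↑ˡ (b + c))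
    σᵇᶜ : Fin (b + c) → Permutation′ n
    σᵇᶜ = σ ∘ (a ↑ʳ_)
    σᵇ : Fin b → Permutation′ n
    σᵇ = σᵇᶜ ∘ (_↑ˡ c)
    σᶜ : Fin c → Permutation′ n
    σᶜ = σᵇᶜ ∘ (b ↑ʳ_)

-- A non-constant property for small `n`

module _ {N : ℕ} where

  AllFalse : Input N → Set
  AllFalse x = ∀ p → lookup x p ≡ false

  allFalse? : ∀ x → Dec (AllFalse x)
  allFalse? x = all? λ p → lookup x p Bool.≟ false

  allFalse : BooleanFunction N
  allFalse = does ∘ allFalse?

  allFalse-nonConstant : Fin N → NonConstant allFalse
  allFalse-nonConstant p = replicate N false , replicate N true ,
    true≢false (dec-true (allFalse? (replicate N false)) (λ q → lookup-replicate q false))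
      (dec-false (allFalse? (replicate N true)) λ all → true≢false (lookup-replicate p true) (all p) refl)

allFalse-property : ∀ n k → IsHypergraphProperty n k allFalse
allFalse-property n k x σ = does-⇔ (mk⇔
  (λ all p → trans (lookup∘tabulate _ p) (all _))
  (λ all p → trans (cong (lookup x) (sym (Perm.inverseʳ (permuteTuples σ))))
    (trans (sym (lookup∘tabulate _ (permuteTuples σ ⟨$⟩ˡ p))) (all (permuteTuples σ ⟨$⟩ˡ p)))))
  (allFalse? x) (allFalse? (permuteParts σ x))

sensitivity-≤-size : ∀ {N} (f : BooleanFunction N) → sensitivity f ≤ N
sensitivity-≤-size f = sensitivity-least f λ x → sensitivityAt-≤ f x (λ p _ → p) (λ _ _ → id)

-- Assembling the family and choosing the group sizes

-- The exponent `d` is detached from `k`, so that rewriting `k` as a sum of group sizes leaves it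
-- fixed.
HasLowSensitivityProperty : ℕ → ℕ → Set
HasLowSensitivityProperty k d =
  Σ[ c ∈ ℕ ] 0 < c ×
  (Σ[ f ∈ (∀ (n : ℕ) .{{_ : NonZero n}} → BooleanFunction (n ^ k)) ]
    (∀ (n : ℕ) .{{_ : NonZero n}} →
      NonConstant (f n) ×
      IsHypergraphProperty n k (f n) ×
      sensitivity (f n) ≤ c * n ^ d))

balanced⇒lowSensitivity : ∀ a d → a ≤ d → 1 ≤ d → HasLowSensitivityProperty (a + (d + d)) d
-- The summand 16 counts the 4 rows and 12 columns of a pattern; `12 ^ k` bounds the number of bits
-- when `n` is below 12.
balanced⇒lowSensitivity a d a≤d 1≤d = 16 + 12 ^ k , s≤s z≤n , (λ n → f (12 ℕ.≤? n)) , λ n → correct (12 ℕ.≤? n)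
  where
  k = a + (d + d)

  f : ∀ {n} → Dec (12 ≤ n) → BooleanFunction (n ^ k)
  f {n} (yes _) = Tensor.existsPattern (tensor n a d d)
  f {n} (no _)  = allFalse

  correct : ∀ {n} .{{_ : NonZero n}} (d? : Dec (12 ≤ n)) →
            NonConstant (f d?) × IsHypergraphProperty n k (f d?) × sensitivity (f d?) ≤ (16 + 12 ^ k) * n ^ d
  correct {n} (yes 12≤n) =
    Tensor.existsPattern-nonConstant (tensor n a d d) (fromℕ< (ℕ.m^n>0 n a)) (ℕ.≤-trans (ℕ.m≤m+n 4 8) 12≤n^d) 12≤n^d ,
    existsPattern-property n a d d ,
    (begin
      sensitivity (f (yes 12≤n))   ≤⟨ Tensor.sensitivity-existsPattern (tensor n a d d)
                                        -- `16 * n ^ d` unfolds to `n ^ d + 15 * n ^ d`.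
                                        (ℕ.≤-trans (ℕ.^-monoʳ-≤ n a≤d) (ℕ.m≤m+n (n ^ d) (15 * n ^ d)))
                                        (ℕ.≤-reflexive (sym (ℕ.*-distribʳ-+ (n ^ d) 4 12))) ⟩
      16 * n ^ d                   ≤⟨ ℕ.*-monoˡ-≤ (n ^ d) (ℕ.m≤m+n 16 (12 ^ k)) ⟩
      (16 + 12 ^ k) * n ^ d        ∎)
    where
    open ℕ.≤-Reasoning
    12≤n^d : 12 ≤ n ^ d
    12≤n^d = ℕ.≤-trans 12≤n (ℕ.≤-trans (ℕ.≤-reflexive (sym (ℕ.^-identityʳ n))) (ℕ.^-monoʳ-≤ n 1≤d))
  correct {n} (no 12≰n) =
    allFalse-nonConstant (fromℕ< (ℕ.m^n>0 n k)) ,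
    allFalse-property n k ,
    (begin
      sensitivity (f (no 12≰n))  ≤⟨ sensitivity-≤-size (f (no 12≰n)) ⟩
      n ^ k                      ≤⟨ ℕ.^-monoˡ-≤ k (ℕ.<⇒≤ (ℕ.≰⇒> 12≰n)) ⟩
      12 ^ k                     ≤⟨ ℕ.m≤n+m (12 ^ k) 16 ⟩
      16 + 12 ^ k                ≤⟨ ℕ.m≤m*n (16 + 12 ^ k) (n ^ d) {{ℕ.m^n≢0 n d}} ⟩
      (16 + 12 ^ k) * n ^ d      ∎)
    where open ℕ.≤-Reasoning

-- It suffices that `⌈ k /3⌉` is at most `h`, the half of `k` rounded down, that is, `k ≤ 3 * h`.
-- The upper half exceeds `h` by at most 1, and `1 ≤ h` since `2 ≤ k`.
2⌈k/3⌉≤k : ∀ k → 2 ≤ k → ⌈ k /3⌉ + ⌈ k /3⌉ ≤ k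
2⌈k/3⌉≤k k 2≤k = begin
  ⌈ k /3⌉ + ⌈ k /3⌉  ≤⟨ ℕ.+-mono-≤ d≤h d≤h ⟩
  h + h              ≤⟨ ℕ.+-monoʳ-≤ h (ℕ.⌊n/2⌋≤⌈n/2⌉ k) ⟩
  h + ⌈ k /2⌉        ≡⟨ ℕ.⌊n/2⌋+⌈n/2⌉≡n k ⟩
  k                  ∎
  where
  open ℕ.≤-Reasoning
  h = ⌊ k /2⌋
  d≤h : ⌈ k /3⌉ ≤ h
  d≤h = ⌈k/3⌉-least k h (begin
    k            ≡⟨ ℕ.⌊n/2⌋+⌈n/2⌉≡n k ⟨
    h + ⌈ k /2⌉  ≤⟨ ℕ.+-monoʳ-≤ h (ℕ.⌊n/2⌋-mono (ℕ.n≤1+n (suc k))) ⟩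
    h + (1 + h)  ≤⟨ ℕ.+-monoʳ-≤ h (ℕ.+-monoˡ-≤ h (ℕ.⌊n/2⌋-mono 2≤k)) ⟩
    h + (h + h)  ≡⟨ cong (λ l → h + (h + l)) (ℕ.+-identityʳ h) ⟨
    3 * h        ≡⟨ ℕ.*-comm 3 h ⟩
    h * 3        ∎)

theorem3 : ∀ (k : ℕ) → 3 ≤ k →
    Σ[ c ∈ ℕ ] 0 < c ×
    (Σ[ f ∈ (∀ (n : ℕ) .{{_ : NonZero n}} → BooleanFunction (n ^ k)) ]
    (∀ (n : ℕ) .{{_ : NonZero n}} →
    NonConstant (f n) ×
    IsHypergraphProperty n k (f n) ×
    sensitivity (f n) ≤ c * n ^ ⌈ k /3⌉))
-- As `d + d ≤ k`, the truncated subtraction is exact. From `k ≤ d * 3` the first group has size at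
-- most `d`, and with `3 ≤ k` also `1 ≤ d`.
theorem3 k 3≤k = subst (λ k → HasLowSensitivityProperty k d) (ℕ.m∸n+n≡m (2⌈k/3⌉≤k k (ℕ.<⇒≤ 3≤k)))
  (balanced⇒lowSensitivity (k ∸ (d + d)) d
    (ℕ.m≤n+o⇒m∸n≤o k (d + d) (subst (k ≤_) d*3≡ (k≤⌈k/3⌉*3 k)))
    (ℕ.*-cancelʳ-≤ 1 d 3 (ℕ.≤-trans 3≤k (k≤⌈k/3⌉*3 k))))
  where
  d = ⌈ k /3⌉
  d*3≡ : d * 3 ≡ (d + d) + d
  d*3≡ = trans (ℕ.*-comm d 3) (trans (cong (λ l → d + (d + l)) (ℕ.+-identityʳ d)) (sym (ℕ.+-assoc d d d)))
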